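{- $\chi'_<(P_6^{14325})=3$.
   Context: Edge-ordered graph: finite simple graph with a linear order on its edges; isomorphisms preserve order; subgraphs carry induced order. A simple graph can avoid $H$ if some edge-ordering of it has no subgraph isomorphic to $H$. The order chromatic number $\chi'_<(H)$ is the least chromatic number of a finite simple graph that cannot avoid $H$ ($\infty$ if none). $P_6^{14325}$ is the path $v_1v_2v_3v_4v_5v_6$ in which the edges $v_1v_2,v_2v_3,v_3v_4,v_4v_5,v_5v_6$ receive labels $1,4,3,2,5$, edges ordered by label. -}

module Defs where

open import Data.Nat using (ℕ; zero; suc; _<_; _≡ᵇ_; _⊓_)
open import Data.Nat.Properties using (⊓-comm)
open import Data.Bool using (Bool; true; false; _∨_)
open import Data.Bool.Properties using (∨-comm)
open import Data.Fin using (Fin; toℕ)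
open import Data.Fin.Properties using (all?) renaming (_≟_ to _≟ᶠ_)
open import Data.Bool.Properties using () renaming (_≟_ to _≟ᵇ_)
open import Data.Nat.Properties using () renaming (_≟_ to _≟ⁿ_)
open import Data.Product using (Σ; Σ-syntax; _×_; _,_)
open import Data.Sum using (_⊎_)
open import Relation.Nullary using (¬_; Dec)
open import Relation.Nullary.Decidable using (toWitness; _→-dec_; _×-dec_; _⊎-dec_)
open import Relation.Binary.PropositionalEquality using (_≡_; _≢_; refl; cong)
open import Function.Definitions using (Injective)

record Graph : Set where
  field
    n      : ℕ
    adj    : Fin n → Fin n → Bool
    sym    : ∀ u v → adj u v ≡ adj v u
    irrefl : ∀ u → adj u u ≡ false

open Graph public

Colorable : ℕ → Graph → Set
Colorable k G = Σ[ c ∈ (Fin (n G) → Fin k) ]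
  (∀ u v → adj G u v ≡ true → c u ≢ c v)

ChromaticNumber : Graph → ℕ → Set
ChromaticNumber G k = Colorable k G × (∀ m → m < k → ¬ Colorable m G)

-- Edge orderings.  A linear order on the (finitely many) edges of G is
-- represented by a labelling of the edges by naturals that is symmetric
-- (the label of {u,v} does not depend on orientation) and injective on
-- edges; edge e precedes edge e' iff label e < label e'.  Labels of
-- non-edges are irrelevant.

record EdgeOrdering (G : Graph) : Set where
  field
    lab     : Fin (n G) → Fin (n G) → ℕ
    lab-sym : ∀ u v → lab u v ≡ lab v u
    lab-inj : ∀ u v x y → adj G u v ≡ true → adj G x y ≡ true →
              lab u v ≡ lab x y → (u ≡ x × v ≡ y) ⊎ (u ≡ y × v ≡ x)

open EdgeOrdering public

record EOGraph : Set where
  field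
    graph : Graph
    order : EdgeOrdering graph

open EOGraph public

-- G contains a subgraph isomorphic (as an edge-ordered graph) to H:
-- an injective vertex map sending edges of H to edges of G so that the
-- order of the image edges (induced order in G) agrees with that of H.
-- (Strict-order preservation between linear orders is equivalent to being
-- an order isomorphism onto the image.)
Contains : EOGraph → EOGraph → Set
Contains G H =
  Σ[ φ ∈ (Fin (n (graph H)) → Fin (n (graph G))) ]
    Injective _≡_ _≡_ φ
    × (∀ u v → adj (graph H) u v ≡ true → adj (graph G) (φ u) (φ v) ≡ true)
    × (∀ u v x y → adj (graph H) u v ≡ true → adj (graph H) x y ≡ true →
         lab (order H) u v < lab (order H) x y →
         lab (order G) (φ u) (φ v) < lab (order G) (φ x) (φ y))

CanAvoid : Graph → EOGraph → Set
CanAvoid G H = Σ[ o ∈ EdgeOrdering G ] ¬ Contains (record { graph = G ; order = o }) H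

OrderChromaticNumber : EOGraph → ℕ → Set
OrderChromaticNumber H k =
  (Σ[ G ∈ Graph ] ChromaticNumber G k × ¬ CanAvoid G H)
  × (∀ (G : Graph) m → ChromaticNumber G m → m < k → CanAvoid G H)

pathAdj : Fin 6 → Fin 6 → Bool
pathAdj u v = (suc (toℕ u) ≡ᵇ toℕ v) ∨ (suc (toℕ v) ≡ᵇ toℕ u)

private
  suc≢ᵇ : ∀ m → (suc m ≡ᵇ m) ≡ false
  suc≢ᵇ zero    = refl
  suc≢ᵇ (suc m) = suc≢ᵇ m

pathLabelAt : ℕ → ℕ
pathLabelAt 0 = 1
pathLabelAt 1 = 4
pathLabelAt 2 = 3
pathLabelAt 3 = 2
pathLabelAt _ = 5

pathLab : Fin 6 → Fin 6 → ℕ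
pathLab u v = pathLabelAt (toℕ u ⊓ toℕ v)

P6graph : Graph
P6graph = record
  { n = 6
  ; adj = pathAdj
  ; sym = λ u v → ∨-comm (suc (toℕ u) ≡ᵇ toℕ v) (suc (toℕ v) ≡ᵇ toℕ u)
  ; irrefl = λ u → cong₂∨ (suc≢ᵇ (toℕ u))
  }
  where
    cong₂∨ : ∀ {b} → b ≡ false → (b ∨ b) ≡ false
    cong₂∨ refl = refl

private
  injDec : ∀ u v x y → Dec (pathAdj u v ≡ true → pathAdj x y ≡ true →
              pathLab u v ≡ pathLab x y → (u ≡ x × v ≡ y) ⊎ (u ≡ y × v ≡ x))
  injDec u v x y =
    (pathAdj u v ≟ᵇ true) →-dec ((pathAdj x y ≟ᵇ true) →-dec
      ((pathLab u v ≟ⁿ pathLab x y) →-dec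
        (((u ≟ᶠ x) ×-dec (v ≟ᶠ y)) ⊎-dec ((u ≟ᶠ y) ×-dec (v ≟ᶠ x)))))

  pathInj : ∀ u v x y → pathAdj u v ≡ true → pathAdj x y ≡ true →
              pathLab u v ≡ pathLab x y → (u ≡ x × v ≡ y) ⊎ (u ≡ y × v ≡ x)
  pathInj = toWitness {a? = all? λ u → all? λ v → all? λ x → all? λ y → injDec u v x y} _

P6order : EdgeOrdering P6graph
P6order = record
  { lab = pathLab
  ; lab-sym = λ u v → cong pathLabelAt (⊓-comm (toℕ u) (toℕ v))
  ; lab-inj = pathInj
  }

P6-14325 : EOGraph
P6-14325 = record { graph = P6graph ; order = P6order }

{-# OPTIONS --safe #-}
-- Graphs of chromatic number at most 2: if A and B are the colour classes, order the
-- edges ab lexicographically, A-end first.  The edges at a vertex of A are then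
-- consecutive.  But the edges 1, 4 at v₂ enclose the edges 3, 2 at v₄, and the edges
-- 2, 5 at v₅ enclose the edges 4, 3 at v₃, so neither v₂, v₄ nor v₃, v₅ can lie in A.
--
-- A graph of chromatic number 3 that cannot avoid the path: a large complete tripartite
-- graph.  Colour its triangles by the order type of their three edges.  Repeated use of
-- the pigeonhole principle gives two vertices in each class such that the eight
-- triangles they span have the same type; call the classes A, B, C so that
-- ab < bc < ac in each of these triangles.  By symmetry ab′ < a′b.
-- If ac < a′c′ then b′ a c b a′ c′ is the required path, and likewise if ac′ < a′c.
-- Otherwise rename so that a′b′ < a′b, bc′ < bc, and take b′ a′ c b c′ a.
module Submission where

open import Defs
open import Data.Bool using (Bool; true; false; not; if_then_else_)
open import Data.Bool.Properties using (not-¬) renaming (_≟_ to _≟ᵇ_)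
open import Data.Empty using (⊥)
open import Data.Fin using (Fin; zero; suc; toℕ; inject₁; inject≤; combine; remainder)
open import Data.Fin.Patterns using (0F; 1F; 2F; 3F; 4F; 5F)
open import Data.Fin.Properties using (all?; any?; pigeonhole; combine-injective; combine-injectiveˡ; combine-monoˡ-<; remQuot-combine; inject≤-injective; toℕ-injective) renaming (_≟_ to _≟ᶠ_; <⇒≢ to <ᶠ⇒≢)
open import Data.Nat using (ℕ; zero; suc; pred; _+_; _*_; _<_; _≤_; _<?_; z≤n; s≤s; NonZero)
open import Data.Nat.Properties using (<-cmp; <-trans; <-asym; ≤-refl; ≤-pred; ≤-trans; ≤-antisym; ≮⇒≥; n<1+n; m≤n⇒m<n∨m≡n; m≤m*n; m≤n*m; *-monoˡ-≤; m*n≢0)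
open import Data.Product using (∃; ∃-syntax; ∃₂; _×_; _,_; proj₁; proj₂; swap)
open import Data.Sum using (_⊎_; inj₁; inj₂)
open import Data.Vec using (Vec; []; _∷_; lookup)
open import Data.Vec.Relation.Unary.All using ([]; _∷_)
open import Data.Vec.Relation.Unary.AllPairs using ([]; _∷_)
open import Data.Vec.Relation.Unary.Unique.Propositional using (Unique)
open import Data.Vec.Relation.Unary.Unique.Propositional.Properties using (lookup-injective)
open import Function using (_∘_; case_of_; mk⇔)
open import Function.Definitions using (Injective)
open import Relation.Binary.Definitions using (tri<; tri≈; tri>)
open import Relation.Binary.PropositionalEquality using (_≡_; _≢_; refl; trans; cong; cong₂; subst; subst₂; ≢-sym) renaming (sym to ≡-sym)
open import Relation.Nullary using (¬_; does; contradiction)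
open import Relation.Nullary.Decidable using (toWitness; _→-dec_; _×-dec_; _⊎-dec_; dec-true; dec-false; does-⇔)

-- Copies of the path

pathEdge : ∀ u v → pathAdj u v ≡ true →
  ∃[ i ] ((u ≡ inject₁ i × v ≡ suc i) ⊎ (u ≡ suc i × v ≡ inject₁ i))
pathEdge = toWitness
  {a? = all? λ u → all? λ v → (pathAdj u v ≟ᵇ true) →-dec any? λ i →
          ((u ≟ᶠ inject₁ i) ×-dec (v ≟ᶠ suc i)) ⊎-dec ((u ≟ᶠ suc i) ×-dec (v ≟ᶠ inject₁ i))} _

-- Adjacency and labels are symmetric, so facts about edges of the path reduce to the five steps
-- from `inject₁ i` to `suc i`.
pathEdge-elim : ∀ {p} {P : Fin 6 → Fin 6 → Set p} → (∀ {u v} → P u v → P v u) →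
  (∀ i → P (inject₁ i) (suc i)) → ∀ u v → pathAdj u v ≡ true → P u v
pathEdge-elim P-sym P-step u v uv with pathEdge u v uv
... | i , inj₁ (refl , refl) = P-step i
... | i , inj₂ (refl , refl) = P-sym (P-step i)

step⇒strictMono : (f : ℕ → ℕ) → (∀ n → f n < f (suc n)) → ∀ {m n} → m < n → f m < f n
step⇒strictMono f step {m} {suc n} (s≤s m≤n) with m≤n⇒m<n∨m≡n m≤n
... | inj₁ m<n  = <-trans (step⇒strictMono f step m<n) (step n)
... | inj₂ refl = step n

module _ (G : Graph) (o : EdgeOrdering G) where

  -- Read by increasing label, the edges of the path sit at positions 0, 3, 2, 1, 4. Four
  -- comparisons of neighbours in this list therefore fix the whole order, by transitivity.
  path⇒Contains : (vs : Vec (Fin (n G)) 6) → Unique vs →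
    (∀ i → adj G (lookup vs (inject₁ i)) (lookup vs (suc i)) ≡ true) →
    (let ℓ : Fin 5 → ℕ
         ℓ i = lab o (lookup vs (inject₁ i)) (lookup vs (suc i))) →
    ℓ 0F < ℓ 3F → ℓ 3F < ℓ 2F → ℓ 2F < ℓ 1F → ℓ 1F < ℓ 4F →
    Contains (record { graph = G ; order = o }) P6-14325
  path⇒Contains vs uniq edge 1<2 2<3 3<4 4<5 =
      φ
    , (λ {i} {j} → lookup-injective uniq i j)
    , pathEdge-elim (λ {u} {v} → trans (sym G (φ v) (φ u))) edge
    , λ u v x y uv xy uv<xy →
        subst₂ _<_ (≡-sym (lab≡rank u v uv)) (≡-sym (lab≡rank x y xy))
          (step⇒strictMono rank rank-step (pred-pathLab u v x y uv<xy))
    where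
    φ : Fin 6 → Fin (n G)
    φ = lookup vs

    ℓ : Fin 5 → ℕ
    ℓ i = lab o (φ (inject₁ i)) (φ (suc i))

    -- rank m is the label of the image of the edge labelled m + 1; the values for
    -- m > 4 only serve to make rank strictly increasing.
    rank : ℕ → ℕ
    rank 0 = ℓ 0F
    rank 1 = ℓ 3F
    rank 2 = ℓ 2F
    rank 3 = ℓ 1F
    rank (suc (suc (suc (suc m)))) = m + ℓ 4F

    rank-step : ∀ m → rank m < rank (suc m)
    rank-step 0 = 1<2
    rank-step 1 = 2<3
    rank-step 2 = 3<4
    rank-step 3 = 4<5
    rank-step (suc (suc (suc (suc m)))) = n<1+n (m + ℓ 4F)

    lab≡rank : ∀ u v → pathAdj u v ≡ true → lab o (φ u) (φ v) ≡ rank (pred (pathLab u v))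
    lab≡rank = pathEdge-elim
      (λ {u} {v} eq → trans (lab-sym o (φ v) (φ u))
                        (trans eq (cong (rank ∘ pred) (lab-sym P6order u v))))
      λ { 0F → refl ; 1F → refl ; 2F → refl ; 3F → refl ; 4F → refl }

    pathLab>0 : ∀ m → 0 < pathLabelAt m
    pathLab>0 0 = s≤s z≤n
    pathLab>0 1 = s≤s z≤n
    pathLab>0 2 = s≤s z≤n
    pathLab>0 3 = s≤s z≤n
    pathLab>0 (suc (suc (suc (suc _)))) = s≤s z≤n

    pred-< : ∀ {m n} → 0 < m → m < n → pred m < pred n
    pred-< (s≤s _) (s≤s m<n) = m<n

    pred-pathLab : ∀ u v x y → pathLab u v < pathLab x y →
      pred (pathLab u v) < pred (pathLab x y)
    pred-pathLab u v x y = pred-< (pathLab>0 _)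

-- Octahedra all of whose triangles have the same order type

bool-max : (f : Bool → ℕ) → f false ≢ f true → ∃[ k ] f (not k) < f k
bool-max f f≢ with <-cmp (f false) (f true)
... | tri< lt _ _ = true , lt
... | tri≈ _ eq _ = contradiction eq f≢
... | tri> _ _ gt = false , gt

module Octahedron
  (G : Graph) (o : EdgeOrdering G)
  (a b c : Bool → Fin (n G))
  (a-inj : Injective _≡_ _≡_ a) (b-inj : Injective _≡_ _≡_ b) (c-inj : Injective _≡_ _≡_ c)
  (ab : ∀ i j → adj G (a i) (b j) ≡ true)
  (bc : ∀ j k → adj G (b j) (c k) ≡ true)
  (ac : ∀ i k → adj G (a i) (c k) ≡ true)
  (ab<bc<ac : ∀ i j k → lab o (a i) (b j) < lab o (b j) (c k) × lab o (b j) (c k) < lab o (a i) (c k))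
  where

  private
    Goal : Set
    Goal = Contains (record { graph = G ; order = o }) P6-14325

    ab<bc : ∀ i j k → lab o (a i) (b j) < lab o (b j) (c k)
    ab<bc i j k = proj₁ (ab<bc<ac i j k)

    bc<ac : ∀ i j k → lab o (b j) (c k) < lab o (a i) (c k)
    bc<ac i j k = proj₂ (ab<bc<ac i j k)

    adj⇒≢ : ∀ {u v} → adj G u v ≡ true → u ≢ v
    adj⇒≢ {u} uv refl with () ← trans (≡-sym uv) (irrefl G u)

    adj-sym : ∀ {u v} → adj G u v ≡ true → adj G v u ≡ true
    adj-sym {u} {v} = trans (sym G v u)

    flipˡ : ∀ {u v m} → lab o u v < m → lab o v u < m
    flipˡ {u} {v} {m} = subst (_< m) (lab-sym o u v)

    flipʳ : ∀ {u v m} → m < lab o u v → m < lab o v u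
    flipʳ {u} {v} {m} = subst (m <_) (lab-sym o u v)

    a≢b : ∀ i j → a i ≢ b j
    a≢b i j = adj⇒≢ (ab i j)

    b≢c : ∀ j k → b j ≢ c k
    b≢c j k = adj⇒≢ (bc j k)

    a≢c : ∀ i k → a i ≢ c k
    a≢c i k = adj⇒≢ (ac i k)

  -- The outer two of the four comparisons are the hypotheses; ba′ < bc comes from the triangle
  -- a′bc, and bc < ac from the triangle abc.
  path-bacbac : ∀ {i i′ j j′ k k′} → i ≢ i′ → j ≢ j′ → k ≢ k′ →
    lab o (a i) (b j′) < lab o (a i′) (b j) → lab o (a i) (c k) < lab o (a i′) (c k′) → Goal
  path-bacbac {i} {i′} {j} {j′} {k} {k′} i≢i′ j≢j′ k≢k′ ab′<a′b ac<a′c′ =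
    path⇒Contains G o
      (b j′ ∷ a i ∷ c k ∷ b j ∷ a i′ ∷ c k′ ∷ [])
      ( (≢-sym (a≢b i j′) ∷ b≢c j′ k ∷ j≢j′ ∘ ≡-sym ∘ b-inj ∷ ≢-sym (a≢b i′ j′) ∷ b≢c j′ k′ ∷ [])
      ∷ (a≢c i k ∷ a≢b i j ∷ i≢i′ ∘ a-inj ∷ a≢c i k′ ∷ [])
      ∷ (≢-sym (b≢c j k) ∷ ≢-sym (a≢c i′ k) ∷ k≢k′ ∘ c-inj ∷ [])
      ∷ (≢-sym (a≢b i′ j) ∷ b≢c j k′ ∷ [])
      ∷ (a≢c i′ k′ ∷ [])
      ∷ [] ∷ [])
      (λ { 0F → adj-sym (ab i j′) ; 1F → ac i k ; 2F → adj-sym (bc j k)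
         ; 3F → adj-sym (ab i′ j) ; 4F → ac i′ k′ })
      (flipˡ (flipʳ ab′<a′b))
      (flipˡ (flipʳ (ab<bc i′ j k)))
      (flipˡ (bc<ac i j k))
      ac<a′c′

  path-bacbca : ∀ {i i′ j j′ k k′} → i ≢ i′ → j ≢ j′ → k ≢ k′ →
    lab o (a i) (b j′) < lab o (a i) (b j) → lab o (b j) (c k′) < lab o (b j) (c k) →
    lab o (a i) (c k) < lab o (a i′) (c k′) → Goal
  path-bacbca {i} {i′} {j} {j′} {k} {k′} i≢i′ j≢j′ k≢k′ ab′<ab bc′<bc ac<a′c′ =
    path⇒Contains G o
      (b j′ ∷ a i ∷ c k ∷ b j ∷ c k′ ∷ a i′ ∷ [])
      ( (≢-sym (a≢b i j′) ∷ b≢c j′ k ∷ j≢j′ ∘ ≡-sym ∘ b-inj ∷ b≢c j′ k′ ∷ ≢-sym (a≢b i′ j′) ∷ [])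
      ∷ (a≢c i k ∷ a≢b i j ∷ a≢c i k′ ∷ i≢i′ ∘ a-inj ∷ [])
      ∷ (≢-sym (b≢c j k) ∷ k≢k′ ∘ c-inj ∷ ≢-sym (a≢c i′ k) ∷ [])
      ∷ (b≢c j k′ ∷ ≢-sym (a≢b i′ j) ∷ [])
      ∷ (≢-sym (a≢c i′ k′) ∷ [])
      ∷ [] ∷ [])
      (λ { 0F → adj-sym (ab i j′) ; 1F → ac i k ; 2F → adj-sym (bc j k)
         ; 3F → bc j k′ ; 4F → adj-sym (ac i′ k′) })
      -- ab′ and bc′ are disjoint, so no triangle compares them directly; ab, which meets both,
      -- links them.
      (flipˡ (<-trans ab′<ab (ab<bc i j k′)))
      (flipʳ bc′<bc)
      (flipˡ (bc<ac i j k))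
      (flipʳ ac<a′c′)

  private
    i≢¬i : ∀ {i} → i ≢ not i
    i≢¬i = not-¬ refl

    ab-distinct : ∀ i → lab o (a i) (b false) ≢ lab o (a i) (b true)
    ab-distinct i eq with lab-inj o _ _ _ _ (ab i false) (ab i true) eq
    ... | inj₁ (_ , b≡b′) with () ← b-inj b≡b′
    ... | inj₂ (a≡b , _) = a≢b i true a≡b

    bc-distinct : ∀ j → lab o (b j) (c false) ≢ lab o (b j) (c true)
    bc-distinct j eq with lab-inj o _ _ _ _ (bc j false) (bc j true) eq
    ... | inj₁ (_ , c≡c′) with () ← c-inj c≡c′
    ... | inj₂ (b≡c , _) = b≢c j true b≡c

    ac-distinct : ∀ {i i′ k k′} → i ≢ i′ → lab o (a i) (c k) ≢ lab o (a i′) (c k′)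
    ac-distinct {i} {i′} {k} {k′} i≢i′ eq with lab-inj o _ _ _ _ (ac i k) (ac i′ k′) eq
    ... | inj₁ (a≡a′ , _) = i≢i′ (a-inj a≡a′)
    ... | inj₂ (a≡c , _) = a≢c i k′ a≡c

    diagonal : ∀ i → lab o (a i) (b (not i)) < lab o (a (not i)) (b i) → Goal
    diagonal i ab′<a′b
      -- `j` names as b the vertex with the later edge to a′, and `k` names as c the one with the
      -- later edge to this b. The choices serve the case a′c < ac′, where `path-bacbca` runs with a
      -- and a′ exchanged; in the case ac′ < a′c, `path-bacbac` keeps the naming of `ab′<a′b`.
      with j , a′b′<a′b ← bool-max (λ j → lab o (a (not i)) (b j)) (ab-distinct (not i))
      with k , bc′<bc ← bool-max (λ k → lab o (b j) (c k)) (bc-distinct j)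
      with <-cmp (lab o (a i) (c (not k))) (lab o (a (not i)) (c k))
    ... | tri< ac′<a′c _ _ = path-bacbac i≢¬i i≢¬i (≢-sym i≢¬i) ab′<a′b ac′<a′c
    ... | tri≈ _ eq _      = contradiction eq (ac-distinct i≢¬i)
    ... | tri> _ _ a′c<ac′ = path-bacbca (≢-sym i≢¬i) i≢¬i i≢¬i a′b′<a′b bc′<bc a′c<ac′

  -- The two edges compared are disjoint, so their labels differ; the two outcomes are exchanged by
  -- swapping the indices in A and B, which is the argument of `diagonal`.
  octahedron⇒Contains : Goal
  octahedron⇒Contains with <-cmp (lab o (a false) (b true)) (lab o (a true) (b false))
  ... | tri< lt _ _ = diagonal false lt
  ... | tri> _ _ gt = diagonal true gt
  ... | tri≈ _ eq _ with lab-inj o _ _ _ _ (ab false true) (ab true false) eq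
  ...   | inj₁ (a≡a′ , _) with () ← a-inj a≡a′
  ...   | inj₂ (a≡b , _) = contradiction a≡b (a≢b false false)

-- Monochromatic boxes

pair : ∀ {A : Set} → A → A → Bool → A
pair x y s = if s then y else x

pair-injective : ∀ {A : Set} {x y : A} → x ≢ y → Injective _≡_ _≡_ (pair x y)
pair-injective x≢y {false} {false} _  = refl
pair-injective x≢y {false} {true}  eq = contradiction eq x≢y
pair-injective x≢y {true}  {false} eq = contradiction (≡-sym eq) x≢y
pair-injective x≢y {true}  {true}  _  = refl

-- There are only s * k pairs of a configuration w and its colour t, so two of the
-- s * k + 1 values of z share both.
doubling : ∀ {W X I : Set} {P : W → Set} {s k} (enc : W → Fin s) → Injective _≡_ _≡_ enc →
  (cell : W → I → X) (f : X → Fin (suc (s * k)) → Fin k) →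
  (∀ z → ∃₂ λ w t → P w × (∀ i → f (cell w i) z ≡ t)) →
  ∃[ w ] ∃[ z ] ∃[ z′ ] ∃[ t ] P w × z ≢ z′ × (∀ i j → f (cell w i) (pair z z′ j) ≡ t)
doubling {W} {P = P} {k = k} enc enc-inj cell f mono
  with z , z′ , z<z′ , eq ← pigeonhole (n<1+n _)
    (λ z → combine (enc (proj₁ (mono z))) (proj₁ (proj₂ (mono z))))
  with w≡w′ , t≡t′ ← combine-injective (enc (proj₁ (mono z))) _ (enc (proj₁ (mono z′))) _ eq
  = w , z , z′ , t , Pw , <ᶠ⇒≢ z<z′ , λ
      { i false → f≡t i
      ; i true  → trans (cong (λ w → f (cell w i) z′) (enc-inj w≡w′))
                    (trans (proj₂ (proj₂ (proj₂ (mono z′))) i) (≡-sym t≡t′)) }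
  where
  w : W
  w = proj₁ (mono z)
  t : Fin k
  t = proj₁ (proj₂ (mono z))
  Pw : P w
  Pw = proj₁ (proj₂ (proj₂ (mono z)))
  f≡t : ∀ i → f (cell w i) z ≡ t
  f≡t = proj₂ (proj₂ (proj₂ (mono z)))

encPair : ∀ {l m} → Fin l × Fin m → Fin (l * m)
encPair (x , y) = combine x y

encPair-injective : ∀ {l m} → Injective _≡_ _≡_ (encPair {l} {m})
encPair-injective {x = x , y} {x′ , y′} eq =
  let x≡x′ , y≡y′ = combine-injective x y x′ y′ eq in cong₂ _,_ x≡x′ y≡y′

-- Both sides have the form `suc (s * k)` required by `doubling`. For the grid, `s` counts the pairs
-- of x-values; for the box, it counts pairs of x-values together with pairs of y-values.
gridSide : ℕ → ℕ
gridSide k = suc (suc k * suc k * k)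

boxSide : ℕ → ℕ
boxSide k = suc (suc k * suc k * (gridSide k * gridSide k) * k)

Distinct : ∀ {A : Set} → A × A → Set
Distinct (x , x′) = x ≢ x′

mono-pair : ∀ k (f : Fin (suc k) → Fin k) →
  ∃₂ λ ((x , x′) : Fin (suc k) × Fin (suc k)) t → x ≢ x′ × (∀ i → f (pair x x′ i) ≡ t)
mono-pair k f with x , x′ , x<x′ , eq ← pigeonhole (n<1+n k) f =
  (x , x′) , f x , <ᶠ⇒≢ x<x′ , λ { false → refl ; true → ≡-sym eq }

-- Every row y contains two equally coloured entries by `mono-pair`; `doubling` finds two rows that
-- agree on both columns and on the colour.
mono-grid : ∀ k (f : Fin (suc k) → Fin (gridSide k) → Fin k) →
  ∃ λ ((x , x′) : Fin (suc k) × Fin (suc k)) →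
    ∃[ y ] ∃[ y′ ] ∃[ t ] x ≢ x′ × y ≢ y′ ×
    (∀ i j → f (pair x x′ i) (pair y y′ j) ≡ t)
mono-grid k f = doubling {P = Distinct} encPair encPair-injective
  (λ (x , x′) → pair x x′) f (λ y → mono-pair k (λ x → f x y))

-- The sides are left open so that the argument on tripartite graphs uses only the existence of a
-- box and never the concrete sizes.
HasMonoBox : ℕ → ℕ → ℕ → ℕ → Set
HasMonoBox k l m n = (f : Fin l → Fin m → Fin n → Fin k) →
  ∃ λ (((x , x′) , (y , y′)) : (Fin l × Fin l) × (Fin m × Fin m)) →
    ∃[ z ] ∃[ z′ ] ∃[ t ] (x ≢ x′ × y ≢ y′) × z ≢ z′ ×
    (∀ ((i , j) : Bool × Bool) r → f (pair x x′ i) (pair y y′ j) (pair z z′ r) ≡ t)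

-- The same doubling one dimension up: each slice at fixed z contains a monochromatic grid, and two
-- slices share the grid and its colour.
mono-box : ∀ k → HasMonoBox k (suc k) (gridSide k) (boxSide k)
mono-box k f = doubling {P = λ (xs , ys) → Distinct xs × Distinct ys}
  (λ (xs , ys) → encPair (encPair xs , encPair ys))
  (λ {(xs , ys)} {(xs′ , ys′)} eq →
    let exs≡ , eys≡ = combine-injective (encPair xs) (encPair ys) (encPair xs′) (encPair ys′) eq
    in cong₂ _,_ (encPair-injective exs≡) (encPair-injective eys≡))
  (λ ((x , x′) , (y , y′)) (i , j) → pair x x′ i , pair y y′ j)
  (λ (x , y) → f x y)
  λ z → let xs , y , y′ , t , x≢x′ , y≢y′ , mono = mono-grid k (λ x y → f x y z)
        in (xs , (y , y′)) , t , (x≢x′ , y≢y′) , λ (i , j) → mono i j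

-- Order types of triangles

-- In an ordered triangle, `b` is the common vertex of the two smallest edges, `a` that of the
-- smallest and largest, `c` that of the two largest. Hence the six edge orders correspond to the
-- six namings of the vertices, which `HasType` lists.
Ascending : ∀ {V : Set} → (V → V → ℕ) → V → V → V → Set
Ascending L a b c = L a b < L b c × L b c < L a c

HasType : ∀ {V : Set} → (V → V → ℕ) → Fin 6 → V → V → V → Set
HasType L 0F x y z = Ascending L x y z
HasType L 1F x y z = Ascending L y x z
HasType L 2F x y z = Ascending L z y x
HasType L 3F x y z = Ascending L y z x
HasType L 4F x y z = Ascending L z x y
HasType L 5F x y z = Ascending L x z y

orderType : ∀ {V : Set} (L : V → V → ℕ) → (∀ u v → L u v ≡ L v u) → ∀ x y z →
  L x y ≢ L y z → L y z ≢ L x z → L x y ≢ L x z → ∃[ t ] HasType L t x y z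
orderType L L-sym x y z xy≢yz yz≢xz xy≢xz
  with <-cmp (L x y) (L y z) | <-cmp (L y z) (L x z) | <-cmp (L x y) (L x z)
... | tri≈ _ eq _  | _             | _             = contradiction eq xy≢yz
... | _            | tri≈ _ eq _   | _             = contradiction eq yz≢xz
... | _            | _             | tri≈ _ eq _   = contradiction eq xy≢xz
-- `p`, `q`, `r` are the labels of xy, yz, xz. Of the eight outcomes, the two cyclic ones are
-- impossible; the wildcards of the first and last cases absorb them.
... | tri< p<q _ _ | tri< q<r _ _  | _             = 0F , p<q , q<r
... | tri< _ _ _   | tri> _ _ r<q  | tri< p<r _ _  = 1F , subst (_< L x z) (L-sym x y) p<r , r<q
... | tri< p<q _ _ | tri> _ _ _    | tri> _ _ r<p  =
  4F , subst (_< L x y) (L-sym x z) r<p , subst (L x y <_) (L-sym y z) p<q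
... | tri> _ _ q<p | tri< _ _ _    | tri< p<r _ _  =
  2F , subst₂ _<_ (L-sym y z) (L-sym x y) q<p , subst₂ _<_ (L-sym x y) (L-sym x z) p<r
... | tri> _ _ _   | tri< q<r _ _  | tri> _ _ r<p  =
  3F , subst (L y z <_) (L-sym x z) q<r , subst₂ _<_ (L-sym x z) (L-sym x y) r<p
... | tri> _ _ q<p | tri> _ _ r<q  | _             =
  5F , subst (L x z <_) (L-sym y z) r<q , subst (_< L x y) (L-sym y z) q<p

-- Complete tripartite graphs

-- A vertex is `combine i r`, where `r` is its class and `i` its index within the class.
class : ∀ p → Fin (p * 3) → Fin 3
class p = remainder {p} 3

tripartite : ℕ → Graph
tripartite p = record
  { n      = p * 3
  ; adj    = λ u v → not (does (class p u ≟ᶠ class p v))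
  ; sym    = λ u v → cong not (does-⇔ (mk⇔ ≡-sym ≡-sym) (class p u ≟ᶠ class p v) (class p v ≟ᶠ class p u))
  ; irrefl = λ u → cong not (dec-true (class p u ≟ᶠ class p u) refl)
  }

tripartite-adj : ∀ p {r s} → r ≢ s → ∀ (i j : Fin p) →
  adj (tripartite p) (combine i r) (combine j s) ≡ true
tripartite-adj p {r} {s} r≢s i j = cong not (dec-false (_ ≟ᶠ _) λ eq →
  r≢s (trans (≡-sym (cong proj₂ (remQuot-combine i r))) (trans eq (cong proj₂ (remQuot-combine j s)))))

-- The index `i` guarantees nonempty classes: the three vertices `combine i r` form a triangle, on
-- which fewer than three colours must repeat.
tripartite-chromatic : ∀ p → Fin p → ChromaticNumber (tripartite p) 3
tripartite-chromatic p i =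
    (class p , λ u v uv cu≡cv →
      case trans (≡-sym uv) (cong not (dec-true (class p u ≟ᶠ class p v) cu≡cv)) of λ ())
  , λ m m<3 (col , proper) →
      let r , s , r<s , eq = pigeonhole m<3 (λ r → col (combine i r))
      in proper _ _ (tripartite-adj p (<ᶠ⇒≢ r<s) i i) eq

module _ {p l m q : ℕ} (monoBox : HasMonoBox 6 l m q) (l≤p : l ≤ p) (m≤p : m ≤ p) (q≤p : q ≤ p)
         (o : EdgeOrdering (tripartite p)) where

  private
    V : Set
    V = Fin (p * 3)

    _~_ : V → V → Set
    u ~ v = adj (tripartite p) u v ≡ true

    point : ∀ {s} → s ≤ p → Fin 3 → Fin s → V
    point s≤p r i = combine (inject≤ i s≤p) r

    point-injective : ∀ {s} (s≤p : s ≤ p) r → Injective _≡_ _≡_ (point s≤p r)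
    point-injective s≤p r {i} {j} eq =
      inject≤-injective s≤p s≤p i j (combine-injectiveˡ (inject≤ i s≤p) r (inject≤ j s≤p) r eq)

    X : Fin l → V
    X = point l≤p 0F

    Y : Fin m → V
    Y = point m≤p 1F

    Z : Fin q → V
    Z = point q≤p 2F

    ~-point : ∀ {s s′ r r′} (s≤p : s ≤ p) (s′≤p : s′ ≤ p) → r ≢ r′ → ∀ i j →
      point s≤p r i ~ point s′≤p r′ j
    ~-point s≤p s′≤p r≢r′ i j = tripartite-adj p r≢r′ (inject≤ i s≤p) (inject≤ j s′≤p)

    X~Y : ∀ i j → X i ~ Y j
    X~Y = ~-point {r = 0F} {r′ = 1F} l≤p m≤p λ ()

    Y~X : ∀ j i → Y j ~ X i
    Y~X = ~-point {r = 1F} {r′ = 0F} m≤p l≤p λ ()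

    Y~Z : ∀ j k → Y j ~ Z k
    Y~Z = ~-point {r = 1F} {r′ = 2F} m≤p q≤p λ ()

    Z~Y : ∀ k j → Z k ~ Y j
    Z~Y = ~-point {r = 2F} {r′ = 1F} q≤p m≤p λ ()

    X~Z : ∀ i k → X i ~ Z k
    X~Z = ~-point {r = 0F} {r′ = 2F} l≤p q≤p λ ()

    Z~X : ∀ k i → Z k ~ X i
    Z~X = ~-point {r = 2F} {r′ = 0F} q≤p l≤p λ ()

    ~⇒≢ : ∀ {u v} → u ~ v → u ≢ v
    ~⇒≢ {u} uv refl with () ← trans (≡-sym uv) (irrefl (tripartite p) u)

    lab-distinct : ∀ {u v x y} → u ~ v → x ~ y → u ≢ x → u ≢ y → lab o u v ≢ lab o x y
    lab-distinct uv xy u≢x u≢y eq with lab-inj o _ _ _ _ uv xy eq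
    ... | inj₁ (u≡x , _) = u≢x u≡x
    ... | inj₂ (u≡y , _) = u≢y u≡y

    type : ∀ i j k → ∃[ t ] HasType (lab o) t (X i) (Y j) (Z k)
    type i j k = orderType (lab o) (lab-sym o) (X i) (Y j) (Z k)
      (lab-distinct (X~Y i j) (Y~Z j k) (~⇒≢ (X~Y i j)) (~⇒≢ (X~Z i k)))
      (lab-distinct (Y~Z j k) (X~Z i k) (~⇒≢ (Y~X j i)) (~⇒≢ (Y~Z j k)))
      -- The edges xy and xz share their first end, so xy is reversed to start at y, the end that
      -- tells them apart.
      (lab-distinct (Y~X j i) (X~Z i k) (~⇒≢ (Y~X j i)) (~⇒≢ (Y~Z j k)) ∘ trans (lab-sym o (Y j) (X i)))

  tripartite-Contains : Contains (record { graph = tripartite p ; order = o }) P6-14325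
  tripartite-Contains
    with ((x , x′) , (y , y′)) , z , z′ , t , (x≢x′ , y≢y′) , z≢z′ , mono
      ← monoBox (λ i j k → proj₁ (type i j k))
    = byType t λ i j k → subst (λ t → HasType (lab o) t (X (xs i)) (Y (ys j)) (Z (zs k))) (mono (i , j) k)
        (proj₂ (type (xs i) (ys j) (zs k)))
    where
    xs : Bool → Fin l
    xs = pair x x′

    ys : Bool → Fin m
    ys = pair y y′

    zs : Bool → Fin q
    zs = pair z z′

    xs-inj : Injective _≡_ _≡_ (X ∘ xs)
    xs-inj {i} {j} eq = pair-injective x≢x′ (point-injective l≤p 0F {xs i} {xs j} eq)

    ys-inj : Injective _≡_ _≡_ (Y ∘ ys)
    ys-inj {i} {j} eq = pair-injective y≢y′ (point-injective m≤p 1F {ys i} {ys j} eq)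

    zs-inj : Injective _≡_ _≡_ (Z ∘ zs)
    zs-inj {i} {j} eq = pair-injective z≢z′ (point-injective q≤p 2F {zs i} {zs j} eq)

    -- Each type permutes the three classes into the roles A, B, C, and `asc` with its arguments
    -- permuted alike is the hypothesis on triangles in `Octahedron`.
    byType : ∀ t → (∀ i j k → HasType (lab o) t (X (xs i)) (Y (ys j)) (Z (zs k))) →
      Contains (record { graph = tripartite p ; order = o }) P6-14325
    byType 0F asc = Octahedron.octahedron⇒Contains (tripartite p) o
      (X ∘ xs) (Y ∘ ys) (Z ∘ zs) xs-inj ys-inj zs-inj
      (λ i j → X~Y (xs i) (ys j)) (λ i j → Y~Z (ys i) (zs j)) (λ i j → X~Z (xs i) (zs j)) (λ i j k → asc i j k)
    byType 1F asc = Octahedron.octahedron⇒Contains (tripartite p) o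
      (Y ∘ ys) (X ∘ xs) (Z ∘ zs) ys-inj xs-inj zs-inj
      (λ i j → Y~X (ys i) (xs j)) (λ i j → X~Z (xs i) (zs j)) (λ i j → Y~Z (ys i) (zs j)) (λ j i k → asc i j k)
    byType 2F asc = Octahedron.octahedron⇒Contains (tripartite p) o
      (Z ∘ zs) (Y ∘ ys) (X ∘ xs) zs-inj ys-inj xs-inj
      (λ i j → Z~Y (zs i) (ys j)) (λ i j → Y~X (ys i) (xs j)) (λ i j → Z~X (zs i) (xs j)) (λ k j i → asc i j k)
    byType 3F asc = Octahedron.octahedron⇒Contains (tripartite p) o
      (Y ∘ ys) (Z ∘ zs) (X ∘ xs) ys-inj zs-inj xs-inj
      (λ i j → Y~Z (ys i) (zs j)) (λ i j → Z~X (zs i) (xs j)) (λ i j → Y~X (ys i) (xs j)) (λ j k i → asc i j k)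
    byType 4F asc = Octahedron.octahedron⇒Contains (tripartite p) o
      (Z ∘ zs) (X ∘ xs) (Y ∘ ys) zs-inj xs-inj ys-inj
      (λ i j → Z~X (zs i) (xs j)) (λ i j → X~Y (xs i) (ys j)) (λ i j → Z~Y (zs i) (ys j)) (λ k i j → asc i j k)
    byType 5F asc = Octahedron.octahedron⇒Contains (tripartite p) o
      (X ∘ xs) (Z ∘ zs) (Y ∘ ys) xs-inj zs-inj ys-inj
      (λ i j → X~Z (xs i) (zs j)) (λ i j → Z~Y (zs i) (ys j)) (λ i j → X~Y (xs i) (ys j)) (λ i k j → asc i j k)

k<gridSide : ∀ k → suc k ≤ gridSide k
k<gridSide k = s≤s (m≤n*m k (suc k * suc k))

gridSide≤boxSide : ∀ k → gridSide k ≤ boxSide k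
gridSide≤boxSide k = s≤s (*-monoˡ-≤ k {suc k * suc k} (m≤m*n (suc k * suc k) (gridSide k * gridSide k) {{nonZero}}))
  where
  nonZero : NonZero (gridSide k * gridSide k)
  nonZero = m*n≢0 (gridSide k) (gridSide k)

tripartite-unavoidable : ∀ p → boxSide 6 ≤ p → ¬ CanAvoid (tripartite p) P6-14325
tripartite-unavoidable p box≤p (o , avoids) =
  avoids (tripartite-Contains (mono-box 6) (≤-trans (k<gridSide 6) grid≤p) grid≤p box≤p o)
  where
  grid≤p : gridSide 6 ≤ p
  grid≤p = ≤-trans (gridSide≤boxSide 6) box≤p

-- Bipartite graphs

module _ (G : Graph) (c : Fin (n G) → Fin 2) (proper : ∀ u v → adj G u v ≡ true → c u ≢ c v) where

  private
    V : Set
    V = Fin (n G)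

    -- Edges have ends of colours 0 and 1; all other pairs get the junk label 0.
    lexLab : Fin 2 → Fin 2 → V → V → ℕ
    lexLab 0F 1F u v = toℕ (combine u v)
    lexLab 1F 0F u v = toℕ (combine v u)
    lexLab _  _  _ _ = 0

    lexLab-sym : ∀ r s u v → lexLab r s u v ≡ lexLab s r v u
    lexLab-sym 0F 0F _ _ = refl
    lexLab-sym 0F 1F _ _ = refl
    lexLab-sym 1F 0F _ _ = refl
    lexLab-sym 1F 1F _ _ = refl

    lexLab-inj : ∀ r s r′ s′ u v x y → r ≢ s → r′ ≢ s′ →
      lexLab r s u v ≡ lexLab r′ s′ x y → (u ≡ x × v ≡ y) ⊎ (u ≡ y × v ≡ x)
    lexLab-inj 0F 0F _  _  u v x y r≢s _ _ = contradiction refl r≢s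
    lexLab-inj 1F 1F _  _  u v x y r≢s _ _ = contradiction refl r≢s
    lexLab-inj _  _  0F 0F u v x y _ r≢s _ = contradiction refl r≢s
    lexLab-inj _  _  1F 1F u v x y _ r≢s _ = contradiction refl r≢s
    lexLab-inj 0F 1F 0F 1F u v x y _ _ eq = inj₁ (combine-injective u v x y (toℕ-injective eq))
    lexLab-inj 0F 1F 1F 0F u v x y _ _ eq = inj₂ (combine-injective u v y x (toℕ-injective eq))
    lexLab-inj 1F 0F 0F 1F u v x y _ _ eq = inj₂ (swap (combine-injective v u x y (toℕ-injective eq)))
    lexLab-inj 1F 0F 1F 0F u v x y _ _ eq = inj₁ (swap (combine-injective v u y x (toℕ-injective eq)))

    lexLab-first : ∀ r s u v → r ≡ 0F → r ≢ s → lexLab r s u v ≡ toℕ (combine u v)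
    lexLab-first 0F 0F _ _ _ r≢s = contradiction refl r≢s
    lexLab-first 0F 1F _ _ _ _ = refl

  lexOrder : EdgeOrdering G
  lexOrder = record
    { lab     = λ u v → lexLab (c u) (c v) u v
    ; lab-sym = λ u v → lexLab-sym (c u) (c v) u v
    ; lab-inj = λ u v x y uv xy →
        lexLab-inj (c u) (c v) (c x) (c y) u v x y (proper u v uv) (proper x y xy)
    }

  -- If `x` came before `u`, then every label at `x` would be below every label at `u`, since
  -- `combine` compares first coordinates first.
  lexOrder-mono : ∀ {u v x y} → adj G u v ≡ true → adj G x y ≡ true → c u ≡ 0F → c x ≡ 0F →
    lab lexOrder u v < lab lexOrder x y → toℕ u ≤ toℕ x
  lexOrder-mono {u} {v} {x} {y} uv xy cu cx uv<xy = ≮⇒≥ λ x<u → <-asym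
    (subst₂ _<_ (lexLab-first (c u) (c v) u v cu (proper u v uv)) (lexLab-first (c x) (c y) x y cx (proper x y xy)) uv<xy)
    (combine-monoˡ-< y v x<u)

  -- This is the consecutiveness of the edges at a vertex of colour 0: one comparison yields u ≤ x,
  -- the other x ≤ u.
  lexOrder-interval : ∀ {u v v′ x y y′} →
    adj G u v ≡ true → adj G u v′ ≡ true → adj G x y ≡ true → adj G x y′ ≡ true →
    c u ≡ 0F → c x ≡ 0F → lab lexOrder u v < lab lexOrder x y →
    lab lexOrder x y′ < lab lexOrder u v′ → u ≡ x
  lexOrder-interval uv uv′ xy xy′ cu cx lt gt =
    toℕ-injective (≤-antisym (lexOrder-mono uv xy cu cx lt) (lexOrder-mono xy′ uv′ cx cu gt))

  lexOrder-avoids : ¬ Contains (record { graph = G ; order = lexOrder }) P6-14325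
  lexOrder-avoids (φ , φ-inj , φ-adj , φ-lab)
    = byColour (c (φ 1F)) (c (φ 2F)) (c (φ 3F)) (c (φ 4F)) refl refl refl refl
    where
    -- Vertex v₂ is `1F`, and so on. Colours alternate along the path, so v₂, v₄ or v₃, v₅ both have
    -- colour 0, and `lexOrder-interval` would identify them. The later clauses give an edge with
    -- equally coloured ends.
    byColour : ∀ r s r′ s′ → c (φ 1F) ≡ r → c (φ 2F) ≡ s → c (φ 3F) ≡ r′ → c (φ 4F) ≡ s′ → ⊥
    byColour 0F _  0F _  c₂ _ c₄ _ =
      case φ-inj (lexOrder-interval (φ-adj 1F 0F refl) (φ-adj 1F 2F refl) (φ-adj 3F 4F refl) (φ-adj 3F 2F refl)
        c₂ c₄ (φ-lab 1F 0F 3F 4F refl refl (toWitness {a? = 1 <? 2} _))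
        (φ-lab 3F 2F 1F 2F refl refl (toWitness {a? = 3 <? 4} _))) of λ ()
    byColour _  0F _  0F _ c₃ _ c₅ =
      case φ-inj (lexOrder-interval (φ-adj 4F 3F refl) (φ-adj 4F 5F refl) (φ-adj 2F 3F refl) (φ-adj 2F 1F refl)
        c₅ c₃ (φ-lab 4F 3F 2F 3F refl refl (toWitness {a? = 2 <? 3} _))
        (φ-lab 2F 1F 4F 5F refl refl (toWitness {a? = 4 <? 5} _))) of λ ()
    byColour 0F 0F _  _  c₂ c₃ _ _ = proper _ _ (φ-adj 1F 2F refl) (trans c₂ (≡-sym c₃))
    byColour 1F 1F _  _  c₂ c₃ _ _ = proper _ _ (φ-adj 1F 2F refl) (trans c₂ (≡-sym c₃))
    byColour _  0F 0F _  _ c₃ c₄ _ = proper _ _ (φ-adj 2F 3F refl) (trans c₃ (≡-sym c₄))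
    byColour _  1F 1F _  _ c₃ c₄ _ = proper _ _ (φ-adj 2F 3F refl) (trans c₃ (≡-sym c₄))
    byColour _  _  1F 1F _ _ c₄ c₅ = proper _ _ (φ-adj 3F 4F refl) (trans c₄ (≡-sym c₅))

Colorable-mono : ∀ {k l} → k ≤ l → ∀ G → Colorable k G → Colorable l G
Colorable-mono k≤l G (c , proper) =
  (λ u → inject≤ (c u) k≤l) , λ u v uv → proper u v uv ∘ inject≤-injective k≤l k≤l (c u) (c v)

bipartite-CanAvoid : ∀ G → Colorable 2 G → CanAvoid G P6-14325
bipartite-CanAvoid G (c , proper) = lexOrder G c proper , lexOrder-avoids G c proper

theorem4p17 : OrderChromaticNumber P6-14325 3
theorem4p17 =
    (tripartite (boxSide 6) , tripartite-chromatic (boxSide 6) zero , tripartite-unavoidable (boxSide 6) ≤-refl)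
  -- Chromatic numbers 0 and 1 are covered by reading the colouring as one with two colours.
  , λ G m (colorable , _) m<3 → bipartite-CanAvoid G (Colorable-mono (≤-pred m<3) G colorable)
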